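{- The conditional cuckoo filter with chaining returns no false negatives. That is, let $H$ be the filter obtained from the empty filter by inserting, in any order, finitely many rows $(k,\mathbf{a})$ of a dataset $D$, where no insertion ends with outcome "Terminated". Let $k$ be a key and $P$ an equality predicate such that some row $(k,\mathbf{a})\in D$ with key $k$ satisfies $P(\mathbf{a})=\mathrm{true}$. Then the query for $(k,P)$ on $H$ returns True.
   Context: **Data.** A row is a pair $(k,\mathbf{a})$ of a key $k$ and an attribute vector $\mathbf{a}=(a_1,\dots,a_r)$. An equality predicate $P$ is given by a set of indices $I\subseteq\{1,\dots,r\}$ and values $(c_i)_{i\in I}$; $P(\mathbf{a})=\mathrm{true}$ iff $a_i=c_i$ for all $i\in I$. **Table.** $H$ is a table of $m$ buckets, indexed by $\{0,\dots,m-1\}$ with $m$ a power of two, each holding at most $b$ entries. $H_\ell$ is the (multi)set of entries in bucket $\ell$. An entry is a pair $(\kappa,\alpha)$ of a key fingerprint and an attribute fingerprint vector. The parameters are positive integers: $d$ (maximum number of copies of a key fingerprint in a bucket pair), $L_{max}$ (maximum number of bucket pairs in a chain), and MaxKicks. **Hash functions** (arbitrary fixed functions). A key $k$ has a fingerprint $\kappa=\kappa(k)$ and an initial bucket $\ell_1(k)$. A fingerprint $\kappa$ has an offset $h(\kappa)\in\{0,\dots,m-1\}$. The alternate bucket of $\ell$ for $\kappa$ is $\ell'=\ell\oplus h(\kappa)$ (bitwise XOR), and $\{\ell,\ell'\}$ is the bucket pair of $\ell$ for $\kappa$. The next bucket in the chain is $\tilde\ell=g(\min\{\ell,\ell'\},\kappa)$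 for a fixed function $g$ with values in $\{0,\dots,m-1\}$. The attribute fingerprint vector of $\mathbf{a}$ is $\alpha=(f_1(a_1),\dots,f_r(a_r))$ for fixed functions $f_i$. The number of copies of $\kappa$ in the pair $\ell,\ell'$ is the number of entries stored in the bucket set $\{\ell,\ell'\}$ whose key fingerprint is $\kappa$ (each stored entry counted once, also if $\ell=\ell'$). **Insertion of $(k,\mathbf{a})$.** Compute $\kappa,\alpha$, set $\ell=\ell_1(k)$, and process the bucket pair $\ell,\ell'=\ell\oplus h(\kappa)$ as follows. 1. If $(\kappa,\alpha)\in H_\ell\cup H_{\ell'}$, stop (Success). 2. Otherwise, if the pair contains exactly $d$ copies of $\kappa$: if this is the $L_{max}$-th bucket pair processed, discard the row and stop; else replace $\ell$ by $g(\min\{\ell,\ell'\},\kappa)$ and process the new pair from step 1. 3. Otherwise, if $H_\ell$ is not full, put $(\kappa,\alpha)$ in $H_\ell$ and stop (Success). 4. Otherwise repeat up to MaxKicks times: if $H_{\ell'}$ is not full, put the entry in hand in $H_{\ell'}$ and stop (Success); else swap the entry in hand with an arbitrary (random) entry of $H_{\ell'}$ (a "kick"), and, with $\kappa$ now denoting the key fingerprint of the new entry in hand, replace $\ell'$ by $\ell'\oplus h(\kappa)$. If the repetitions are exhausted, the outcome is "Terminated" (the insertion has failed). **Query for $(k,P)$.** Set $\ell=\ell_1(k)$, $\kappa=\kappa(k)$. For up to $L_{max}$ bucket pairs: let $\ell'=\ell\oplus h(\kappa)$; if some entry $(\kappa,\alpha)\in H_\ell\cup H_{\ell'}$ has $\alpha_i=f_i(c_i)$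 for all $i\in I$, return True; else if the pair contains exactly $d$ copies of $\kappa$, replace $\ell$ by $g(\min\{\ell,\ell'\},\kappa)$ and continue; else return False. If $L_{max}$ pairs have been checked and the last one also contains $d$ copies of $\kappa$, return True. -}

module Defs where

open import Algebra.Construct.NaturalChoice.Min using () renaming (_⊓_ to min)
open import Data.Bool.Base using (Bool; true; false; if_then_else_)
open import Data.Empty using (⊥-elim)
open import Data.Fin.Base using (Fin; zero; suc; finToFun; funToFin)
open import Data.Fin.Properties as Fin using (all?)
open import Data.Fin.Subset using (Subset; _∈_)
open import Data.Fin.Subset.Properties using (_∈?_)
open import Data.List.Base as List using (List; []; _∷_; _++_; length; filter; _[_]∷=_)
open import Data.List.Relation.Unary.Any using (Any; any?)
open import Data.Nat.Base using (ℕ; zero; suc; _^_; _<_; NonZero)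
import Data.Nat.Properties as ℕ
open import Data.Product.Base using (_×_; _,_; proj₁; proj₂)
open import Data.Vec.Base using (Vec; replicate; lookup; _[_]≔_)
open import Data.Vec.Properties.WithK using ([]=-irrelevant)
open import Relation.Binary.Definitions using (DecidableEquality)
open import Relation.Binary.PropositionalEquality using (_≡_; _≢_; cong; trans)
open import Relation.Nullary.Decidable using (Dec; yes; no; does; map′; _×-dec_)
open import Relation.Nullary.Negation using (¬_)

xorBit : Fin 2 → Fin 2 → Fin 2
xorBit zero       y          = y
xorBit (suc zero) zero       = suc zero
xorBit (suc zero) (suc zero) = zero

-- finToFun lists the base-2 digits of a number below 2 ^ e, so this is
-- bitwise XOR on {0, …, 2 ^ e - 1}.
xor : ∀ {e} → Fin (2 ^ e) → Fin (2 ^ e) → Fin (2 ^ e)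
xor {e} x y =
  funToFin {e} {2} (λ i → xorBit (finToFun {2} {e} x i) (finToFun {2} {e} y i))

record Parameters : Set₁ where
  field
    r      : ℕ
    Key    : Set
    Attr   : Fin r → Set
    KeyFp  : Set
    AttrFp : Fin r → Set
    _≟κ_   : DecidableEquality KeyFp
    _≟α_   : ∀ {i} → DecidableEquality (AttrFp i)

    e b d Lmax MaxKicks : ℕ
    {{d≢0}}        : NonZero d
    {{Lmax≢0}}     : NonZero Lmax
    {{MaxKicks≢0}} : NonZero MaxKicks

  m : ℕ
  m = 2 ^ e

  field
    fingerprint   : Key → KeyFp
    initialBucket : Key → Fin m
    h             : KeyFp → Fin m
    g             : Fin m → KeyFp → Fin m
    f             : ∀ i → Attr i → AttrFp i

module Filter (params : Parameters) where
  open Parameters params public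

  AttrVector : Set
  AttrVector = ∀ i → Attr i

  Row : Set
  Row = Key × AttrVector

  FpVector : Set
  FpVector = ∀ i → AttrFp i

  Entry : Set
  Entry = KeyFp × FpVector

  -- Fingerprint vectors are functions, so entries are compared componentwise.
  _≈_ : Entry → Entry → Set
  (κ , α) ≈ (κ′ , α′) = κ ≡ κ′ × (∀ i → α i ≡ α′ i)

  entryOf : Row → Entry
  entryOf (k , a) = fingerprint k , λ i → f i (a i)

  record Predicate : Set where
    field
      I : Subset r
      c : ∀ i → i ∈ I → Attr i

  open Predicate public

  Satisfies : Predicate → AttrVector → Set
  Satisfies P a = ∀ i (i∈I : i ∈ I P) → a i ≡ c P i i∈I

  -- A bucket is a multiset; the order of the list is never consulted.
  -- Entries are only added to buckets with fewer than b entries, so every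
  -- table built from the empty one has at most b entries per bucket.
  Table : Set
  Table = Vec (List Entry) m

  empty : Table
  empty = replicate m []

  NotFull : Table → Fin m → Set
  NotFull H ℓ = length (lookup H ℓ) < b

  put : Table → Fin m → Entry → Table
  put H ℓ x = H [ ℓ ]≔ (x ∷ lookup H ℓ)

  replaceAt : (H : Table) (ℓ : Fin m) → Fin (length (lookup H ℓ)) → Entry → Table
  replaceAt H ℓ j x = H [ ℓ ]≔ (lookup H ℓ [ j ]∷= x)

  alt : Fin m → KeyFp → Fin m
  alt ℓ κ = xor {e} ℓ (h κ)

  next : Fin m → KeyFp → Fin m
  next ℓ κ = g (min (Fin.≤-totalOrder m) ℓ (alt ℓ κ)) κ

  -- The contents of the bucket set {ℓ, alt ℓ κ}, which may be a singleton.
  pairEntries : Table → Fin m → KeyFp → List Entry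
  pairEntries H ℓ κ =
    if does (ℓ Fin.≟ alt ℓ κ)
    then lookup H ℓ
    else lookup H ℓ ++ lookup H (alt ℓ κ)

  copies : Table → Fin m → KeyFp → ℕ
  copies H ℓ κ = length (filter (λ x → proj₁ x ≟κ κ) (pairEntries H ℓ κ))

  Stored : Table → Fin m → Entry → Set
  Stored H ℓ x = Any (x ≈_) (pairEntries H ℓ (proj₁ x))

  data Outcome : Set where
    success discarded terminated : Outcome

  -- Kick n x ℓ′ H o H′: with n repetitions left, entry x in hand and target
  -- bucket ℓ′, the kicking loop can turn H into H′ with outcome o.  The kicked
  -- entry is arbitrary, hence a relation.
  data Kick : ℕ → Entry → Fin m → Table → Outcome → Table → Set where
    exhausted : ∀ {x ℓ′ H} →
      Kick zero x ℓ′ H terminated H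
    place : ∀ {n x ℓ′ H} →
      NotFull H ℓ′ →
      Kick (suc n) x ℓ′ H success (put H ℓ′ x)
    swap : ∀ {n x ℓ′ H o H′} →
      ¬ NotFull H ℓ′ →
      (j : Fin (length (lookup H ℓ′))) →
      let y = List.lookup (lookup H ℓ′) j in
      Kick n y (alt ℓ′ (proj₁ y)) (replaceAt H ℓ′ j x) o H′ →
      Kick (suc n) x ℓ′ H o H′

  -- Process n x ℓ H o H′: the pair of ℓ is processed for x, where n counts the
  -- pairs that may still be processed, including this one.
  data Process : ℕ → Entry → Fin m → Table → Outcome → Table → Set where
    present : ∀ {n x ℓ H} →
      Stored H ℓ x →
      Process (suc n) x ℓ H success H
    discard : ∀ {x ℓ H} →
      ¬ Stored H ℓ x →
      copies H ℓ (proj₁ x) ≡ d →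
      Process 1 x ℓ H discarded H
    chain : ∀ {n x ℓ H o H′} →
      ¬ Stored H ℓ x →
      copies H ℓ (proj₁ x) ≡ d →
      Process (suc n) x (next ℓ (proj₁ x)) H o H′ →
      Process (suc (suc n)) x ℓ H o H′
    place : ∀ {n x ℓ H} →
      ¬ Stored H ℓ x →
      copies H ℓ (proj₁ x) ≢ d →
      NotFull H ℓ →
      Process (suc n) x ℓ H success (put H ℓ x)
    kick : ∀ {n x ℓ H o H′} →
      ¬ Stored H ℓ x →
      copies H ℓ (proj₁ x) ≢ d →
      ¬ NotFull H ℓ →
      Kick MaxKicks x (alt ℓ (proj₁ x)) H o H′ →
      Process (suc n) x ℓ H o H′

  Insert : Row → Table → Outcome → Table → Set
  Insert (k , a) = Process Lmax (entryOf (k , a)) (initialBucket k)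

  data InsertAll : List Row → Table → Table → Set where
    []  : ∀ {H} → InsertAll [] H H
    _∷_ : ∀ {row rows H o H′ H″} →
      Insert row H o H′ × o ≢ terminated →
      InsertAll rows H′ H″ →
      InsertAll (row ∷ rows) H H″

  Matches : Predicate → KeyFp → Entry → Set
  Matches P κ (κ′ , α) =
    κ′ ≡ κ × (∀ i (i∈I : i ∈ I P) → α i ≡ f i (c P i i∈I))

  matches? : ∀ P κ x → Dec (Matches P κ x)
  matches? P κ (κ′ , α) = (κ′ ≟κ κ) ×-dec all? agrees?
    where
    agrees? : ∀ i → Dec ((i∈I : i ∈ I P) → α i ≡ f i (c P i i∈I))
    agrees? i with i ∈? I P
    ... | no  i∉I = yes (λ i∈I → ⊥-elim (i∉I i∈I))
    ... | yes i∈I = map′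
      (λ eq i∈I′ → trans eq (cong (λ p → f i (c P i p)) ([]=-irrelevant i∈I i∈I′)))
      (λ eqs → eqs i∈I)
      (α i ≟α f i (c P i i∈I))

  -- The first argument counts the pairs that may still be checked; it reaches
  -- zero only after Lmax pairs, the last of which also had d copies of κ.
  queryFrom : ℕ → KeyFp → Predicate → Fin m → Table → Bool
  queryFrom zero    κ P ℓ H = true
  queryFrom (suc n) κ P ℓ H =
    if does (any? (matches? P κ) (pairEntries H ℓ κ)) then true
    else if does (copies H ℓ κ ℕ.≟ d) then queryFrom n κ P (next ℓ κ) H
    else false

  query : Key → Predicate → Table → Bool
  query k P = queryFrom Lmax (fingerprint k) P (initialBucket k)

{-# OPTIONS --safe #-}

-- For a fixed fingerprint κ the alternate-bucket map is an involution, so the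
-- bucket pairs for κ partition the table, and a kick moves an entry only within
-- its own pair.  A completed insertion therefore changes the multiset of entries
-- with fingerprint κ in a pair by at most the inserted entry, and not at all if
-- the pair already held d copies of κ.  Hence stored entries stay in their pair
-- and pairs with d copies keep exactly d copies: the chain walked when a row was
-- inserted is walked again by every later query.

module Submission where

open import Defs
open import Data.Bool.Base using (true; false; if_then_else_)
open import Data.Fin.Base using (Fin; zero; suc; finToFun; funToFin; combine)
open import Data.Fin.Properties as Fin using (finToFun-funToFin; funToFin-finToFin)
open import Data.List.Base using (List; []; _∷_; [_]; _++_; length; filter; lookup; _[_]∷=_)
open import Data.List.Membership.Propositional using (_∈_)
open import Data.List.Properties using (++-assoc; filter-++; filter-reject)
open import Data.List.Relation.Binary.Permutation.Propositional
  using (_↭_; ↭-refl; ↭-reflexive; ↭-sym; ↭-trans; prep; swap; module PermutationReasoning)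
open import Data.List.Relation.Binary.Permutation.Propositional.Properties
  using (++⁺ˡ; ++-comm; shifts; filter-↭; ↭-length; Any-resp-↭; ∈-resp-↭)
  renaming (++⁺ʳ to ↭-++⁺ʳ)
open import Data.List.Relation.Unary.Any as Any using (Any; here; there; any?)
open import Data.List.Relation.Unary.Any.Properties
  using (++⁺ʳ; lookup-result) renaming (filter⁺ to Any-filter⁺; filter⁻ to Any-filter⁻)
open import Data.Nat.Base using (ℕ; zero; suc; _^_)
import Data.Nat.Properties as ℕ
open import Data.Product.Base using (_×_; _,_; proj₁; proj₂)
open import Data.Sum.Base using (_⊎_; inj₁; inj₂)
open import Data.Unit.Base using (⊤; tt)
import Data.Vec.Base as Vec
open import Data.Vec.Properties using (lookup∘update; lookup∘update′)
open import Function.Base using (_∘_)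
open import Relation.Binary.PropositionalEquality
  using (_≡_; _≢_; _≗_; refl; sym; trans; cong; cong₂; subst)
open import Relation.Nullary.Decidable using (Dec; yes; no; does; dec-true; dec-false; _⊎-dec_)
open import Relation.Nullary.Negation using (¬_; contradiction)

-- Cancellation for bitwise XOR, and exchange of a list element.

xorBit-cancelʳ : ∀ x y → xorBit (xorBit x y) y ≡ x
xorBit-cancelʳ zero       zero       = refl
xorBit-cancelʳ zero       (suc zero) = refl
xorBit-cancelʳ (suc zero) zero       = refl
xorBit-cancelʳ (suc zero) (suc zero) = refl

funToFin-cong : ∀ {m n} {f g : Fin m → Fin n} → f ≗ g → funToFin f ≡ funToFin g
funToFin-cong {zero}  f≗g = refl
funToFin-cong {suc m} f≗g = cong₂ combine (f≗g zero) (funToFin-cong (f≗g ∘ suc))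

xor-cancelʳ : ∀ {e} (x y : Fin (2 ^ e)) → xor {e} (xor {e} x y) y ≡ x
xor-cancelʳ {e} x y = trans (funToFin-cong {e} bits) (funToFin-finToFin {e} {2} x)
  where
  bits : ∀ i → xorBit (finToFun {2} {e} (xor {e} x y) i) (finToFun {2} {e} y i) ≡ finToFun {2} {e} x i
  bits i = trans (cong (λ z → xorBit z (finToFun {2} {e} y i)) (finToFun-funToFin {e} _ i))
                 (xorBit-cancelʳ _ _)

-- Conservation law for one kick: the exchange only redistributes entries between the hand and the
-- bucket.
lookup-∷=-↭ : ∀ {A : Set} (xs : List A) (j : Fin (length xs)) (x : A) →
  lookup xs j ∷ (xs [ j ]∷= x) ↭ x ∷ xs
lookup-∷=-↭ (y ∷ xs) zero    x = swap y x ↭-refl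
lookup-∷=-↭ (y ∷ xs) (suc j) x =
  ↭-trans (swap _ y ↭-refl) (↭-trans (prep y (lookup-∷=-↭ xs j x)) (swap y x ↭-refl))

module _ (params : Parameters) where
  open Filter params

  -- Bucket pairs and the entries they hold.

  alt-involutive : ∀ ℓ κ → alt (alt ℓ κ) κ ≡ ℓ
  alt-involutive ℓ κ = xor-cancelʳ {e} ℓ (h κ)

  InPair : Fin m → Fin m → KeyFp → Set
  InPair ℓ₂ ℓ κ = ℓ₂ ≡ ℓ ⊎ ℓ₂ ≡ alt ℓ κ

  inPair? : ∀ ℓ₂ ℓ κ → Dec (InPair ℓ₂ ℓ κ)
  inPair? ℓ₂ ℓ κ = (ℓ₂ Fin.≟ ℓ) ⊎-dec (ℓ₂ Fin.≟ alt ℓ κ)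

  InPair-alt : ∀ {ℓ₂ ℓ κ} → InPair ℓ₂ ℓ κ → InPair (alt ℓ₂ κ) ℓ κ
  InPair-alt (inj₁ refl) = inj₂ refl
  InPair-alt (inj₂ refl) = inj₁ (alt-involutive _ _)

  InPair-alt⁻ : ∀ {ℓ₂ ℓ κ} → InPair (alt ℓ₂ κ) ℓ κ → InPair ℓ₂ ℓ κ
  InPair-alt⁻ {ℓ₂} {ℓ} {κ} p = subst (λ z → InPair z ℓ κ) (alt-involutive ℓ₂ κ) (InPair-alt p)

  InPair-single : ∀ {ℓ₂ ℓ κ} → ℓ ≡ alt ℓ κ → InPair ℓ₂ ℓ κ → ℓ₂ ≡ ℓ
  InPair-single _  (inj₁ ℓ₂≡ℓ)  = ℓ₂≡ℓ
  InPair-single eq (inj₂ ℓ₂≡ℓ′) = trans ℓ₂≡ℓ′ (sym eq)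

  pairEntries-single : ∀ H {ℓ κ} → ℓ ≡ alt ℓ κ → pairEntries H ℓ κ ≡ Vec.lookup H ℓ
  pairEntries-single H {ℓ} {κ} eq rewrite dec-true (ℓ Fin.≟ alt ℓ κ) eq = refl

  pairEntries-double : ∀ H {ℓ κ} → ℓ ≢ alt ℓ κ →
    pairEntries H ℓ κ ≡ Vec.lookup H ℓ ++ Vec.lookup H (alt ℓ κ)
  pairEntries-double H {ℓ} {κ} neq rewrite dec-false (ℓ Fin.≟ alt ℓ κ) neq = refl

  -- Starting from the other bucket lists the same two buckets in the opposite order, hence a
  -- permutation and not an equality.
  pairEntries-alt : ∀ H ℓ κ → pairEntries H (alt ℓ κ) κ ↭ pairEntries H ℓ κ
  pairEntries-alt H ℓ κ with ℓ Fin.≟ alt ℓ κ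
  ... | yes eq = ↭-reflexive (trans (cong (λ z → pairEntries H z κ) (sym eq)) (pairEntries-single H eq))
  ... | no neq = begin
    pairEntries H (alt ℓ κ) κ
      ≡⟨ pairEntries-double H (λ eq → neq (sym (trans eq (alt-involutive ℓ κ)))) ⟩
    Vec.lookup H (alt ℓ κ) ++ Vec.lookup H (alt (alt ℓ κ) κ)
      ≡⟨ cong (λ z → Vec.lookup H (alt ℓ κ) ++ Vec.lookup H z) (alt-involutive ℓ κ) ⟩
    Vec.lookup H (alt ℓ κ) ++ Vec.lookup H ℓ
      ↭⟨ ++-comm (Vec.lookup H (alt ℓ κ)) (Vec.lookup H ℓ) ⟩
    Vec.lookup H ℓ ++ Vec.lookup H (alt ℓ κ) ∎
    where open PermutationReasoning

  pairEntries-update-∉ : ∀ H {ℓ₂ ℓ κ} ys → ¬ InPair ℓ₂ ℓ κ →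
    pairEntries (H Vec.[ ℓ₂ ]≔ ys) ℓ κ ≡ pairEntries H ℓ κ
  pairEntries-update-∉ H {ℓ₂} {ℓ} {κ} ys out
    rewrite lookup∘update′ {i = ℓ} {ℓ₂} (out ∘ inj₁ ∘ sym) H ys
          | lookup∘update′ {i = alt ℓ κ} {ℓ₂} (out ∘ inj₂ ∘ sym) H ys
    = refl

  module _ (H : Table) (as bs ys : List Entry) where
    open PermutationReasoning

    -- Here `bs` enters the bucket and `as` leaves it. Writing them on opposite sides avoids
    -- multiset subtraction and treats a plain `put` and a swap alike.
    pairEntries-update-∈ : ∀ ℓ₂ ℓ κ → as ++ ys ↭ bs ++ Vec.lookup H ℓ₂ → InPair ℓ₂ ℓ κ →
      as ++ pairEntries (H Vec.[ ℓ₂ ]≔ ys) ℓ κ ↭ bs ++ pairEntries H ℓ κ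
    pairEntries-update-∈ ℓ₂ ℓ κ p inP with ℓ Fin.≟ alt ℓ κ
    -- A singleton pair lists its bucket once, so `p` is already the claim.
    ... | yes eq with refl ← InPair-single eq inP = begin
      as ++ Vec.lookup (H Vec.[ ℓ ]≔ ys) ℓ ≡⟨ cong (as ++_) (lookup∘update ℓ H ys) ⟩
      as ++ ys                             ↭⟨ p ⟩
      bs ++ Vec.lookup H ℓ                 ∎
    pairEntries-update-∈ ℓ₂ ℓ κ p (inj₁ refl) | no neq = begin
      as ++ (Vec.lookup H′ ℓ ++ Vec.lookup H′ ℓ′)
        ≡⟨ cong₂ (λ u v → as ++ (u ++ v)) (lookup∘update ℓ H ys) (lookup∘update′ (neq ∘ sym) H ys) ⟩
      as ++ (ys ++ Vec.lookup H ℓ′)              ≡⟨ ++-assoc as ys _ ⟨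
      (as ++ ys) ++ Vec.lookup H ℓ′              ↭⟨ ↭-++⁺ʳ (Vec.lookup H ℓ′) p ⟩
      (bs ++ Vec.lookup H ℓ) ++ Vec.lookup H ℓ′  ≡⟨ ++-assoc bs _ _ ⟩
      bs ++ (Vec.lookup H ℓ ++ Vec.lookup H ℓ′)  ∎
      where
      ℓ′ = alt ℓ κ
      H′ = H Vec.[ ℓ ]≔ ys
    pairEntries-update-∈ ℓ₂ ℓ κ p (inj₂ refl) | no neq = begin
      as ++ (Vec.lookup H′ ℓ ++ Vec.lookup H′ ℓ′)
        ≡⟨ cong₂ (λ u v → as ++ (u ++ v)) (lookup∘update′ neq H ys) (lookup∘update ℓ′ H ys) ⟩
      as ++ (Vec.lookup H ℓ ++ ys)               ↭⟨ shifts as (Vec.lookup H ℓ) ⟩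
      Vec.lookup H ℓ ++ (as ++ ys)               ↭⟨ ++⁺ˡ (Vec.lookup H ℓ) p ⟩
      Vec.lookup H ℓ ++ (bs ++ Vec.lookup H ℓ′)  ↭⟨ shifts (Vec.lookup H ℓ) bs ⟩
      bs ++ (Vec.lookup H ℓ ++ Vec.lookup H ℓ′)  ∎
      where
      ℓ′ = alt ℓ κ
      H′ = H Vec.[ ℓ′ ]≔ ys

  -- Accounting for the entries of one fingerprint in a pair.

  hasKey? : ∀ κ (x : Entry) → Dec (proj₁ x ≡ κ)
  hasKey? κ x = proj₁ x ≟κ κ

  contents : Table → Fin m → KeyFp → List Entry
  contents H ℓ κ = filter (hasKey? κ) (pairEntries H ℓ κ)

  opaque
    -- What the entries zs, located in bucket ℓ₂ (or in hand and about to be put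
    -- there), contribute to contents H ℓ κ.
    share : Fin m → List Entry → Fin m → KeyFp → List Entry
    share ℓ₂ zs ℓ κ = if does (inPair? ℓ₂ ℓ κ) then filter (hasKey? κ) zs else []

    share-∈ : ∀ {ℓ₂ ℓ κ} zs → InPair ℓ₂ ℓ κ → share ℓ₂ zs ℓ κ ≡ filter (hasKey? κ) zs
    share-∈ {ℓ₂} {ℓ} {κ} zs inP rewrite dec-true (inPair? ℓ₂ ℓ κ) inP = refl

    share-∉ : ∀ {ℓ₂ ℓ κ} zs → ¬ InPair ℓ₂ ℓ κ → share ℓ₂ zs ℓ κ ≡ []
    share-∉ {ℓ₂} {ℓ} {κ} zs out rewrite dec-false (inPair? ℓ₂ ℓ κ) out = refl

  share-otherKey : ∀ ℓ₂ y ℓ κ → proj₁ y ≢ κ → share ℓ₂ [ y ] ℓ κ ≡ []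
  share-otherKey ℓ₂ y ℓ κ neq with inPair? ℓ₂ ℓ κ
  ... | yes inP = trans (share-∈ [ y ] inP) (filter-reject (hasKey? κ) neq)
  ... | no  out = share-∉ [ y ] out

  -- If `y` has fingerprint `κ`, its two candidate buckets lie in the same pair for `κ`; otherwise
  -- it contributes nothing from either. So redirecting a kicked entry to its alternate bucket does
  -- not alter the accounts.
  share-alt : ∀ ℓ₂ y ℓ κ → share (alt ℓ₂ (proj₁ y)) [ y ] ℓ κ ≡ share ℓ₂ [ y ] ℓ κ
  share-alt ℓ₂ y ℓ κ with proj₁ y ≟κ κ
  ... | no neq = trans (share-otherKey _ y ℓ κ neq) (sym (share-otherKey ℓ₂ y ℓ κ neq))
  ... | yes refl with inPair? ℓ₂ ℓ κ
  ...   | yes inP = trans (share-∈ [ y ] (InPair-alt inP)) (sym (share-∈ [ y ] inP))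
  ...   | no  out = trans (share-∉ [ y ] (out ∘ InPair-alt⁻)) (sym (share-∉ [ y ] out))

  contents-update : ∀ H ℓ₂ as bs ys → as ++ ys ↭ bs ++ Vec.lookup H ℓ₂ → ∀ ℓ κ →
    share ℓ₂ as ℓ κ ++ contents (H Vec.[ ℓ₂ ]≔ ys) ℓ κ ↭ share ℓ₂ bs ℓ κ ++ contents H ℓ κ
  contents-update H ℓ₂ as bs ys p ℓ κ with inPair? ℓ₂ ℓ κ
  ... | no out = ↭-reflexive (cong₂ _++_
          (trans (share-∉ as out) (sym (share-∉ bs out)))
          (cong (filter (hasKey? κ)) (pairEntries-update-∉ H ys out)))
  ... | yes inP = begin
    share ℓ₂ as ℓ κ ++ contents H′ ℓ κ
      ≡⟨ cong (_++ contents H′ ℓ κ) (share-∈ as inP) ⟩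
    filter (hasKey? κ) as ++ contents H′ ℓ κ
      ≡⟨ filter-++ (hasKey? κ) as _ ⟨
    filter (hasKey? κ) (as ++ pairEntries H′ ℓ κ)
      ↭⟨ filter-↭ (hasKey? κ) (pairEntries-update-∈ H as bs ys ℓ₂ ℓ κ p inP) ⟩
    filter (hasKey? κ) (bs ++ pairEntries H ℓ κ)
      ≡⟨ filter-++ (hasKey? κ) bs _ ⟩
    filter (hasKey? κ) bs ++ contents H ℓ κ
      ≡⟨ cong (_++ contents H ℓ κ) (share-∈ bs inP) ⟨
    share ℓ₂ bs ℓ κ ++ contents H ℓ κ ∎
    where
    open PermutationReasoning
    H′ = H Vec.[ ℓ₂ ]≔ ys

  -- Only whole pairs are tracked, because kicks may move entries between the two buckets of a pair.
  -- All fingerprints are covered, because the kicked entries may have any.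
  Adds : Entry → Fin m → Table → Table → Set
  Adds x ℓ₂ H H′ = ∀ ℓ κ → contents H′ ℓ κ ↭ share ℓ₂ [ x ] ℓ κ ++ contents H ℓ κ

  put-adds : ∀ x ℓ₂ H → Adds x ℓ₂ H (put H ℓ₂ x)
  put-adds x ℓ₂ H ℓ κ = ↭-trans
    (↭-reflexive (cong (_++ contents (put H ℓ₂ x) ℓ κ) (sym share-[])))
    (contents-update H ℓ₂ [] [ x ] _ ↭-refl ℓ κ)
    where
    share-[] : share ℓ₂ [] ℓ κ ≡ []
    share-[] with inPair? ℓ₂ ℓ κ
    ... | yes inP = share-∈ [] inP
    ... | no  out = share-∉ [] out

  -- The entry in hand counts as lying in its target bucket, and each swap preserves this total. On
  -- success it is really stored there; on termination it would be lost, which the hypothesis on `o`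
  -- excludes.
  kick-adds : ∀ {n x ℓ₂ H o H′} → Kick n x ℓ₂ H o H′ → o ≢ terminated → Adds x ℓ₂ H H′
  kick-adds exhausted o≢t = contradiction refl o≢t
  kick-adds {x = x} {ℓ₂} {H} (place _) _ = put-adds x ℓ₂ H
  kick-adds {x = x} {ℓ₂} {H} {H′ = H′} (swap _ j k) o≢t ℓ κ = begin
    contents H′ ℓ κ
      ↭⟨ kick-adds k o≢t ℓ κ ⟩
    share (alt ℓ₂ (proj₁ y)) [ y ] ℓ κ ++ contents H₁ ℓ κ
      ≡⟨ cong (_++ contents H₁ ℓ κ) (share-alt ℓ₂ y ℓ κ) ⟩
    share ℓ₂ [ y ] ℓ κ ++ contents H₁ ℓ κ
      -- The victim `y` leaves `ℓ₂` and `x` takes its place.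
      ↭⟨ contents-update H ℓ₂ [ y ] [ x ] _ (lookup-∷=-↭ (Vec.lookup H ℓ₂) j x) ℓ κ ⟩
    share ℓ₂ [ x ] ℓ κ ++ contents H ℓ κ ∎
    where
    open PermutationReasoning
    y  = lookup (Vec.lookup H ℓ₂) j
    H₁ = replaceAt H ℓ₂ j x

  -- Monotonicity of tables under insertion.

  InContents : Table → Fin m → Entry → Set
  InContents H ℓ x = Any (x ≈_) (contents H ℓ (proj₁ x))

  stored⇒inContents : ∀ {H ℓ x} → Stored H ℓ x → InContents H ℓ x
  stored⇒inContents {x = x} s with Any-filter⁺ (hasKey? (proj₁ x)) s
  ... | inj₁ t = t
  ... | inj₂ neq = contradiction (sym (proj₁ (lookup-result s))) neq

  inContents⇒stored : ∀ {H ℓ x} → InContents H ℓ x → Stored H ℓ x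
  inContents⇒stored {x = x} = Any-filter⁻ (hasKey? (proj₁ x))

  infix 4 _≼_

  -- Fullness is kept as equality with `d`, not as a lower bound: a query continues along the chain
  -- only at exactly `d` copies.
  record _≼_ (H H′ : Table) : Set where
    field
      keepsStored : ∀ ℓ x → Stored H ℓ x → Stored H′ ℓ x
      keepsFull   : ∀ ℓ κ → copies H ℓ κ ≡ d → copies H′ ℓ κ ≡ d

  open _≼_

  ≼-refl : ∀ {H} → H ≼ H
  ≼-refl = record { keepsStored = λ _ _ s → s ; keepsFull = λ _ _ c → c }

  ≼-trans : ∀ {H H′ H″} → H ≼ H′ → H′ ≼ H″ → H ≼ H″
  ≼-trans p q = record
    { keepsStored = λ ℓ x → keepsStored q ℓ x ∘ keepsStored p ℓ x
    ; keepsFull   = λ ℓ κ → keepsFull q ℓ κ ∘ keepsFull p ℓ κ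
    }

  copies-InPair : ∀ H {ℓ₂ ℓ κ} → InPair ℓ₂ ℓ κ → copies H ℓ₂ κ ≡ copies H ℓ κ
  copies-InPair H (inj₁ refl) = refl
  copies-InPair H {κ = κ} (inj₂ refl) = ↭-length (filter-↭ (hasKey? κ) (pairEntries-alt H _ κ))

  adds⇒≼ : ∀ {x ℓ₂} H H′ → copies H ℓ₂ (proj₁ x) ≢ d → Adds x ℓ₂ H H′ → H ≼ H′
  adds⇒≼ {x} {ℓ₂} H H′ c≢d adds = record { keepsStored = stored ; keepsFull = full }
    where
    stored : ∀ ℓ z → Stored H ℓ z → Stored H′ ℓ z
    stored ℓ z s = inContents⇒stored {H′} {ℓ}
      (Any-resp-↭ (↭-sym (adds ℓ (proj₁ z)))
        (++⁺ʳ (share ℓ₂ [ x ] ℓ (proj₁ z)) (stored⇒inContents {H} {ℓ} s)))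

    unchanged : ∀ {ℓ κ} → share ℓ₂ [ x ] ℓ κ ≡ [] → copies H′ ℓ κ ≡ copies H ℓ κ
    unchanged {ℓ} {κ} eq = ↭-length
      (↭-trans (adds ℓ κ) (↭-reflexive (cong (_++ contents H ℓ κ) eq)))

    full : ∀ ℓ κ → copies H ℓ κ ≡ d → copies H′ ℓ κ ≡ d
    full ℓ κ c with proj₁ x ≟κ κ | inPair? ℓ₂ ℓ κ
    ... | no neq   | _       = trans (unchanged (share-otherKey ℓ₂ x ℓ κ neq)) c
    ... | yes _    | no out  = trans (unchanged (share-∉ [ x ] out)) c
    -- Only the pair of `x` for its own fingerprint gains an entry, and that pair did not hold `d`
    -- copies.
    ... | yes refl | yes inP = contradiction (trans (copies-InPair H inP) c) c≢d

  adds⇒stored : ∀ {x ℓ₂ ℓ} H H′ → InPair ℓ₂ ℓ (proj₁ x) → Adds x ℓ₂ H H′ → Stored H′ ℓ x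
  adds⇒stored {x} {ℓ₂} {ℓ} H H′ inP adds = inContents⇒stored {H′} {ℓ}
    (Any-resp-↭ (↭-sym (adds ℓ (proj₁ x))) inShare)
    where
    inShare : Any (x ≈_) (share ℓ₂ [ x ] ℓ (proj₁ x) ++ contents H ℓ (proj₁ x))
    inShare rewrite share-∈ [ x ] inP | dec-true (hasKey? (proj₁ x) x) refl = here (refl , λ _ → refl)

  -- Chains walked by insertions and queries.

  Covered : ℕ → Entry → Fin m → Table → Set
  -- This default mirrors the query, which answers `true` after running through all allowed pairs;
  -- discarded rows are thereby covered too.
  Covered zero    x ℓ H = ⊤
  Covered (suc n) x ℓ H =
    Stored H ℓ x ⊎ copies H ℓ (proj₁ x) ≡ d × Covered n x (next ℓ (proj₁ x)) H

  Covered-mono : ∀ n {x ℓ H H′} → H ≼ H′ → Covered n x ℓ H → Covered n x ℓ H′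
  Covered-mono zero    _ _              = tt
  Covered-mono (suc n) p (inj₁ s)       = inj₁ (keepsStored p _ _ s)
  Covered-mono (suc n) {x} {ℓ} p (inj₂ (c , q)) =
    inj₂ (keepsFull p ℓ (proj₁ x) c , Covered-mono n p q)

  -- Both conclusions are proved together: in the `chain` case the fullness observed in `H` has to
  -- be carried over to `H′`.
  process-correct : ∀ {n x ℓ H o H′} → Process n x ℓ H o H′ → o ≢ terminated →
    H ≼ H′ × Covered n x ℓ H′
  process-correct (present s)   _ = ≼-refl , inj₁ s
  process-correct (discard _ c) _ = ≼-refl , inj₂ (c , tt)
  process-correct {x = x} {ℓ} (chain _ c p) o≢t =
    let H≼H′ , covered = process-correct p o≢t
    in  H≼H′ , inj₂ (keepsFull H≼H′ ℓ (proj₁ x) c , covered)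
  process-correct {x = x} {ℓ} {H} {H′ = H′} (place _ c≢d _) _ =
    adds⇒≼ H H′ c≢d adds , inj₁ (adds⇒stored H H′ (inj₁ refl) adds)
    where
    adds : Adds x ℓ H H′
    adds = put-adds x ℓ H
  process-correct {x = x} {ℓ} {H} {H′ = H′} (kick _ c≢d _ k) o≢t =
    -- The copies were counted from `ℓ`, but kicking starts at its alternate bucket; the count
    -- depends only on the pair.
    adds⇒≼ H H′ (c≢d ∘ trans (sym (copies-InPair H (inj₂ refl)))) adds ,
    inj₁ (adds⇒stored H H′ (inj₂ refl) adds)
    where
    adds : Adds x (alt ℓ (proj₁ x)) H H′
    adds = kick-adds k o≢t

  insertAll-≼ : ∀ {rows H H′} → InsertAll rows H H′ → H ≼ H′
  insertAll-≼ []                = ≼-refl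
  insertAll-≼ ((p , o≢t) ∷ ins) = ≼-trans (proj₁ (process-correct p o≢t)) (insertAll-≼ ins)

  -- Coverage holds as soon as the row's own insertion ends, and monotonicity carries it through the
  -- later insertions.
  insertAll-covered : ∀ {rows H H′ row} → InsertAll rows H H′ → row ∈ rows →
    Covered Lmax (entryOf row) (initialBucket (proj₁ row)) H′
  insertAll-covered ((p , o≢t) ∷ ins) (here refl) =
    Covered-mono Lmax (insertAll-≼ ins) (proj₂ (process-correct p o≢t))
  insertAll-covered (_ ∷ ins) (there row∈) = insertAll-covered ins row∈

  matches-resp-≈ : ∀ {P κ x y} → x ≈ y → Matches P κ x → Matches P κ y
  matches-resp-≈ (κ≡ , α≡) (key , attrs) =
    trans (sym κ≡) key , λ i i∈I → trans (sym (α≡ i)) (attrs i i∈I)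

  covered⇒queryFrom : ∀ n {P x ℓ H} → Matches P (proj₁ x) x → Covered n x ℓ H →
    queryFrom n (proj₁ x) P ℓ H ≡ true
  covered⇒queryFrom zero    _  _ = refl
  covered⇒queryFrom (suc n) {P} {x} {ℓ} {H} Px (inj₁ s)
    rewrite dec-true (any? (matches? P (proj₁ x)) (pairEntries H ℓ (proj₁ x)))
                     (Any.map (λ x≈y → matches-resp-≈ {P} x≈y Px) s)
    = refl
  covered⇒queryFrom (suc n) {P} {x} {ℓ} {H} Px (inj₂ (c , covered))
    with does (any? (matches? P (proj₁ x)) (pairEntries H ℓ (proj₁ x)))
  -- Some other entry of this full pair may match by collision; the query then stops early, with the
  -- desired answer.
  ... | true = refl
  ... | false
    rewrite dec-true (copies H ℓ (proj₁ x) ℕ.≟ d) c = covered⇒queryFrom n {P} Px covered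

theorem3 : (params : Parameters) → let open Filter params in
    (D rows : List Row) (H : Table) →
    rows ↭ D →
    InsertAll rows empty H →
    (k : Key) (P : Predicate) (a : AttrVector) →
    (k , a) ∈ D →
    Satisfies P a →
    query k P H ≡ true
theorem3 params D rows H rows↭D ins k P a ka∈D sat =
  covered⇒queryFrom params Lmax {P}
    -- Equal attribute values have equal fingerprints, so the row's own entry matches `P`.
    (refl , λ i i∈I → cong (f i) (sat i i∈I))
    (insertAll-covered params ins (∈-resp-↭ (↭-sym rows↭D) ka∈D))
  where open Filter params
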